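{- There is a finite set $\mathcal{U}$ of unary operations on $\mathbb{N}$ which is a substitution basis for the class of unary Kalmár elementary functions; that is, the smallest set of unary operations $\mathbb{N}\to\mathbb{N}$ which contains $\mathcal{U}$, all constant unary operations and the identity function, and which is closed under composition, is equal to the set of all unary Kalmár elementary functions.
   Context: $\mathbb{N}$ is the set of non-negative integers. An ($r$-ary, $r\ge 1$) operation on $\mathbb{N}$ is a function $\mathbb{N}^r\to\mathbb{N}$. Truncated subtraction is $x \mathbin{\dot- } y:=\max(x-y,0)$. Closure under substitution means: if $f$ is $r$-ary and $g_1,\dots,g_r$ are $n$-ary operations in the set, then $\vec x\mapsto f(g_1(\vec x),\dots,g_r(\vec x))$ is in the set. The Kalmár elementary functions are the elements of the smallest set of operations on $\mathbb{N}$ that contains the constants, the projections, the addition, and the truncated subtraction, and that is closed under substitution, bounded summation ($(\vec x,y)\mapsto\sum_{z<y}f(\vec x,z)$), and bounded multiplication ($(\vec x,y)\mapsto\prod_{z<y}f(\vec x,z)$). A unary Kalmár elementary function is one of arity $1$. -}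

module Defs where

open import Data.Fin.Base using (Fin)
open import Data.List.Base using (List; applyUpTo)
open import Data.List.Membership.Propositional using (_∈_)
open import Data.Nat.Base using (ℕ; suc; _+_; _∸_)
open import Data.Nat.ListAction using (sum; product)
open import Data.Vec.Base using (Vec; []; _∷_; _∷ʳ_; head; init; last; lookup; tabulate)
open import Function.Base using (id; const; _∘_)
open import Level using (Level; 0ℓ)
open import Relation.Binary.PropositionalEquality using (_≗_)
open import Relation.Unary using (Pred; _≐_)

-- Operations have arity at least one, so closure conditions below are stated
-- at arities of the form suc n.
Op : ℕ → Set
Op r = Vec ℕ r → ℕ

∑< : ℕ → (ℕ → ℕ) → ℕ
∑< y f = sum (applyUpTo f y)

∏< : ℕ → (ℕ → ℕ) → ℕ
∏< y f = product (applyUpTo f y)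

substitute : ∀ {r n} → Op r → (Fin r → Op n) → Op n
substitute f g xs = f (tabulate (λ i → g i xs))

-- In the bounded operators, an argument vector is read as (x⃗ , y) with the
-- bound y in last position; x⃗ may be empty.
boundedSum : ∀ {n} → Op (suc n) → Op (suc n)
boundedSum f xsy = ∑< (last xsy) (λ z → f (init xsy ∷ʳ z))

boundedProduct : ∀ {n} → Op (suc n) → Op (suc n)
boundedProduct f xsy = ∏< (last xsy) (λ z → f (init xsy ∷ʳ z))

plus : Op 2
plus (x ∷ y ∷ []) = x + y

truncatedMinus : Op 2
truncatedMinus (x ∷ y ∷ []) = x ∸ y

-- KalmárElementary n is a set of (n + 1)-ary operations.  The constructor ext
-- makes it a set of functions in the extensional sense: membership must not
-- depend on how a function is presented.
data KalmárElementary : (n : ℕ) → Pred (Op (suc n)) 0ℓ where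
  constant   : ∀ {n} (c : ℕ) → KalmárElementary n (const c)
  projection : ∀ {n} (i : Fin (suc n)) → KalmárElementary n (λ xs → lookup xs i)
  addition   : KalmárElementary 1 plus
  monus      : KalmárElementary 1 truncatedMinus
  substitution   : ∀ {r n} {f : Op (suc r)} {g : Fin (suc r) → Op (suc n)} →
                   KalmárElementary r f → (∀ i → KalmárElementary n (g i)) →
                   KalmárElementary n (substitute f g)
  summation      : ∀ {n} {f : Op (suc n)} →
                   KalmárElementary n f → KalmárElementary n (boundedSum f)
  multiplication : ∀ {n} {f : Op (suc n)} →
                   KalmárElementary n f → KalmárElementary n (boundedProduct f)
  ext : ∀ {n} {f g : Op (suc n)} →
        f ≗ g → KalmárElementary n f → KalmárElementary n g

UnaryKalmárElementary : Pred (ℕ → ℕ) 0ℓ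
UnaryKalmárElementary f = KalmárElementary 0 (f ∘ head)

data SubstitutionClosure (U : List (ℕ → ℕ)) : Pred (ℕ → ℕ) 0ℓ where
  generator   : ∀ {f} → f ∈ U → SubstitutionClosure U f
  constant    : ∀ c → SubstitutionClosure U (const c)
  identity    : SubstitutionClosure U id
  composition : ∀ {f g} → SubstitutionClosure U f → SubstitutionClosure U g →
                SubstitutionClosure U (f ∘ g)
  ext : ∀ {f g} → f ≗ g → SubstitutionClosure U f → SubstitutionClosure U g

IsSubstitutionBasis : ∀ {ℓ : Level} → List (ℕ → ℕ) → Pred (ℕ → ℕ) ℓ → Set ℓ
IsSubstitutionBasis U C = SubstitutionClosure U ≐ C

{-# OPTIONS --safe #-}

-- A program is a composition of generators acting on finite sets of rows ⟨ a , r ⟩,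
-- where a set is the number whose binary digits mark its elements.  A program
-- realizes φ if it replaces every row ⟨ a , r ⟩ by ⟨ φ a , r ⟩: since r is carried
-- along, two values computed one after the other can be paired, and so composition
-- of unary functions alone simulates substitution into functions of several arguments.
-- A bounded sum or product ∑_{z<y} φ(z , x) is computed in parallel: expand every row
-- into one row for each z, run the program of φ once on all of them, and collect
-- the values of the rows descending from the same original row.

module Submission where

open import Data.Fin.Base using (Fin; zero; suc; fromℕ; inject₁)
open import Data.Fin.Patterns using (0F; 1F; 2F)
open import Data.List.Base as List using (List; []; _∷_; applyUpTo)
open import Data.List.Membership.Propositional as List using ()
open import Data.List.Membership.Propositional.Properties as List using ()
open import Data.List.Relation.Unary.All as All using (All; []; _∷_)
open import Data.List.Relation.Unary.All.Properties as All using ()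
open import Data.List.Relation.Unary.Any using (here; there)
open import Data.Nat.Base hiding (_/_; _%_)
open import Data.Nat.DivMod
open import Data.Nat.Properties
open import Data.Nat.ListAction using (sum; product)
open import Data.Product.Base using (Σ-syntax; ∃-syntax; ∃₂; _×_; _,_; proj₁; proj₂)
open import Data.Sum.Base using (inj₁; inj₂)
open import Data.Vec.Base using (Vec; []; _∷_; _∷ʳ_; head; init; last; lookup; tabulate)
open import Data.Vec.Properties using (tabulate∘lookup; lookup∘tabulate; tabulate-cong; init-∷ʳ; last-∷ʳ)
open import Function.Base using (id; const; _∘_)
open import Relation.Binary.PropositionalEquality
open import Relation.Nullary using (yes; no; contradiction)
open import Defs

private variable
  A : Set
  n : ℕ

-- Argument vectors.

last-tabulate : ∀ {n} (g : Fin (suc n) → A) → last (tabulate g) ≡ g (fromℕ n)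
last-tabulate {n = zero}  g = refl
last-tabulate {n = suc n} g = last-tabulate (g ∘ suc)

init-tabulate : ∀ {n} (g : Fin (suc n) → A) → init (tabulate g) ≡ tabulate (g ∘ inject₁)
init-tabulate {n = zero}  g = refl
init-tabulate {n = suc n} g = cong (g zero ∷_) (init-tabulate (g ∘ suc))

-- Defined by looking up in a vector, so that tabulating the extended family returns that vector by
-- `tabulate∘lookup`.
_▷_ : (Fin n → A → ℕ) → (A → ℕ) → Fin (suc n) → A → ℕ
(gs ▷ b) i a = lookup (tabulate (λ j → gs j a) ∷ʳ b a) i

tabulate-▷ : (gs : Fin n → A → ℕ) (b : A → ℕ) (a : A) →
             tabulate (λ i → (gs ▷ b) i a) ≡ tabulate (λ j → gs j a) ∷ʳ b a
tabulate-▷ gs b a = tabulate∘lookup _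

▷-all : (P : (A → ℕ) → Set) {gs : Fin n → A → ℕ} {b : A → ℕ} →
        (∀ i → P (gs i)) → P b → ∀ i → P ((gs ▷ b) i)
▷-all {n = zero}  P pgs pb zero    = pb
▷-all {n = suc _} P pgs pb zero    = pgs zero
▷-all {n = suc _} P pgs pb (suc i) = ▷-all P (pgs ∘ suc) pb i

-- Bounded sums and products.

applyUpTo-cong-< : ∀ {f g : ℕ → ℕ} n → (∀ {i} → i < n → f i ≡ g i) → applyUpTo f n ≡ applyUpTo g n
applyUpTo-cong-< zero    eq = refl
applyUpTo-cong-< (suc n) eq = cong₂ _∷_ (eq z<s) (applyUpTo-cong-< n (eq ∘ s<s))

∑<-nonzero⁺ : ∀ {n} {f : ℕ → ℕ} {i} → i < n → f i ≢ 0 → ∑< n f ≢ 0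
∑<-nonzero⁺ {suc n} {f} {zero}  _     fi≢0 eq = fi≢0 (m+n≡0⇒m≡0 (f 0) eq)
∑<-nonzero⁺ {suc n} {f} {suc i} i<n fi≢0 eq =
  ∑<-nonzero⁺ {n} {f ∘ suc} (s<s⁻¹ i<n) fi≢0 (m+n≡0⇒n≡0 (f 0) eq)

∑<-nonzero⁻ : ∀ n {f : ℕ → ℕ} → ∑< n f ≢ 0 → ∃[ i ] i < n × f i ≢ 0
∑<-nonzero⁻ zero        ≢0 = contradiction refl ≢0
∑<-nonzero⁻ (suc n) {f} ≢0 with f 0 ≟ 0
... | no  f0≢0 = 0 , z<s , f0≢0
... | yes f0≡0 with ∑<-nonzero⁻ n (λ eq → ≢0 (cong₂ _+_ f0≡0 eq))
...   | i , i<n , fi≢0 = suc i , s<s i<n , fi≢0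

-- `decode` and `valueAt` are searches written as sums; this evaluates them once the hit is known to
-- be unique.
∑<-single : ∀ {n} {f : ℕ → ℕ} {i} → i < n → (∀ {j} → f j ≢ 0 → j ≡ i) → ∑< n f ≡ f i
∑<-single {suc n} {f} {zero} _ only = trans (cong (f 0 +_) rest≡0) (+-identityʳ (f 0))
  where
  rest≡0 : ∑< n (f ∘ suc) ≡ 0
  rest≡0 with ∑< n (f ∘ suc) ≟ 0
  ... | yes eq = eq
  ... | no ≢0 = contradiction (only (proj₂ (proj₂ (∑<-nonzero⁻ n ≢0)))) λ ()
∑<-single {suc n} {f} {suc i} i<n only = cong₂ _+_ f0≡0
  (∑<-single (s<s⁻¹ i<n) (λ ≢0 → suc-injective (only ≢0)))
  where
  f0≡0 : f 0 ≡ 0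
  f0≡0 with f 0 ≟ 0
  ... | yes eq = eq
  ... | no ≢0 = contradiction (only ≢0) λ ()

term≤∑< : ∀ {n} (f : ℕ → ℕ) {i} → i < n → f i ≤ ∑< n f
term≤∑< {suc n} f {zero}  _   = m≤m+n (f 0) _
term≤∑< {suc n} f {suc i} i<n = m≤n⇒m≤o+n (f 0) (term≤∑< (f ∘ suc) (s<s⁻¹ i<n))

-- A sum of truth values counts, here the elements of an initial segment; `quotient` expresses
-- division in this way.
∑<-initial-segment : ∀ {n k} {f : ℕ → ℕ} → k ≤ n → (∀ {i} → i < k → f i ≡ 1) →
                     (∀ {i} → k ≤ i → f i ≡ 0) → ∑< n f ≡ k
∑<-initial-segment {zero}  {zero}  _   _   _    = refl
∑<-initial-segment {suc n} {zero}  _   one none =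
  cong₂ _+_ (none z≤n) (∑<-initial-segment {n} z≤n (λ ()) (λ _ → none z≤n))
∑<-initial-segment {suc n} {suc k} k≤n one none =
  cong₂ _+_ (one z<s) (∑<-initial-segment (s≤s⁻¹ k≤n) (one ∘ s<s) (none ∘ s≤s))

-- Multiplication is not an initial function, and neither is exponentiation; this identity and the
-- next supply them as a bounded sum and a bounded product.
∑<-const : ∀ n c → ∑< n (const c) ≡ n * c
∑<-const zero    c = refl
∑<-const (suc n) c = cong (c +_) (∑<-const n c)

∏<-const : ∀ n c → ∏< n (const c) ≡ c ^ n
∏<-const zero    c = refl
∏<-const (suc n) c = cong (c *_) (∏<-const n c)

-- A number is used as a truth value, with nonzero meaning true.

m*n≢0⁺ : ∀ m n → m ≢ 0 → n ≢ 0 → m * n ≢ 0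
m*n≢0⁺ m n m≢0 n≢0 eq with m*n≡0⇒m≡0∨n≡0 m eq
... | inj₁ m≡0 = m≢0 m≡0
... | inj₂ n≡0 = n≢0 n≡0

m*n≢0⁻ˡ : ∀ m n → m * n ≢ 0 → m ≢ 0
m*n≢0⁻ˡ m n ≢0 eq = ≢0 (cong (_* n) eq)

m*n≢0⁻ʳ : ∀ m n → m * n ≢ 0 → n ≢ 0
m*n≢0⁻ʳ m n ≢0 eq = ≢0 (trans (cong (m *_) eq) (*-zeroʳ m))

opaque

  sign : ℕ → ℕ
  sign m = 1 ∸ (1 ∸ m)

  sign≤1 : ∀ m → sign m ≤ 1
  sign≤1 m = m∸n≤m 1 (1 ∸ m)

  sign≢0⁺ : ∀ {m} → m ≢ 0 → sign m ≢ 0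
  sign≢0⁺ {zero}  m≢0 = m≢0
  sign≢0⁺ {suc m} _ eq = contradiction (trans (sym (cong (1 ∸_) (0∸n≡0 m))) eq) λ ()

  sign≢0⁻ : ∀ {m} → sign m ≢ 0 → m ≢ 0
  sign≢0⁻ ≢0 refl = ≢0 refl

opaque

  leq : ℕ → ℕ → ℕ
  leq m n = 1 ∸ (m ∸ n)

  leq-true : ∀ {m n} → m ≤ n → leq m n ≡ 1
  leq-true m≤n = cong (1 ∸_) (m≤n⇒m∸n≡0 m≤n)

  leq-false : ∀ {m n} → n < m → leq m n ≡ 0
  leq-false n<m = m≤n⇒m∸n≡0 (m<n⇒0<n∸m n<m)

opaque

  equals : ℕ → ℕ → ℕ
  equals m n = leq m n * leq n m

  equals-refl : ∀ m → equals m m ≡ 1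
  equals-refl m = cong₂ _*_ (leq-true (≤-refl {m})) (leq-true (≤-refl {m}))

  equals⇒≡ : ∀ {m n} → equals m n ≢ 0 → m ≡ n
  equals⇒≡ {m} {n} ≢0 = ≤-antisym
    (≮⇒≥ λ n<m → m*n≢0⁻ˡ (leq m n) (leq n m) ≢0 (leq-false n<m))
    (≮⇒≥ λ m<n → m*n≢0⁻ʳ (leq m n) (leq n m) ≢0 (leq-false m<n))

  ≡⇒equals : ∀ {m n} → m ≡ n → equals m n ≢ 0
  ≡⇒equals {m} refl eq = contradiction (trans (sym (equals-refl m)) eq) λ ()

-- Pairing

opaque

  -- A polynomial pairing, injective but not onto: 3, for example, is not a pair.
  ⟨_,_⟩ : ℕ → ℕ → ℕ
  ⟨ a , b ⟩ = (a + b) * (a + b) + a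

  m≤m*m : ∀ m → m ≤ m * m
  m≤m*m zero    = z≤n
  m≤m*m (suc m) = m≤m+n (suc m) (m * suc m)

  a≤⟨a,b⟩ : ∀ a b → a ≤ ⟨ a , b ⟩
  a≤⟨a,b⟩ a b = m≤n+m a _

  b≤⟨a,b⟩ : ∀ a b → b ≤ ⟨ a , b ⟩
  b≤⟨a,b⟩ a b = ≤-trans (m≤n+m b a) (≤-trans (m≤m*m (a + b)) (m≤m+n _ a))

  -- The pairs with component sum s lie between s² and s² + s, hence below (s + 1)².
  ⟨⟩-< : ∀ a b c d → a + b < c + d → ⟨ a , b ⟩ < ⟨ c , d ⟩
  ⟨⟩-< a b c d lt = begin-strict
    (a + b) * (a + b) + a             ≤⟨ +-monoʳ-≤ ((a + b) * (a + b)) (m≤m+n a b) ⟩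
    (a + b) * (a + b) + (a + b)       ≡⟨ +-comm _ (a + b) ⟩
    suc (a + b) * (a + b)             <⟨ *-monoʳ-< (suc (a + b)) (n<1+n (a + b)) ⟩
    suc (a + b) * suc (a + b)         ≤⟨ *-mono-≤ lt lt ⟩
    (c + d) * (c + d)                 ≤⟨ m≤m+n _ c ⟩
    (c + d) * (c + d) + c             ∎
    where open ≤-Reasoning

  ⟨⟩-injective : ∀ {a b c d} → ⟨ a , b ⟩ ≡ ⟨ c , d ⟩ → a ≡ c × b ≡ d
  ⟨⟩-injective {a} {b} {c} {d} eq = a≡c , +-cancelˡ-≡ a b d (trans sum≡ (cong (_+ d) (sym a≡c)))
    where
    sum≡ : a + b ≡ c + d
    sum≡ = ≤-antisym (≮⇒≥ λ lt → <-irrefl (sym eq) (⟨⟩-< c d a b lt))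
                     (≮⇒≥ λ lt → <-irrefl eq (⟨⟩-< a b c d lt))
    a≡c : a ≡ c
    a≡c = +-cancelˡ-≡ _ a c (trans eq (cong (λ s → s * s + c) (sym sum≡)))

opaque

  -- Both components of a pair are at most the pair, so the search below `suc p` finds them. The
  -- value at a number that is not a pair is 0.
  decode : (ℕ → ℕ → ℕ) → ℕ → ℕ
  decode σ p = ∑< (suc p) λ a → ∑< (suc p) λ b → equals ⟨ a , b ⟩ p * σ a b

  decode-⟨⟩ : ∀ σ a b → decode σ ⟨ a , b ⟩ ≡ σ a b
  decode-⟨⟩ σ a b = begin
    ∑< (suc p) (λ a → ∑< (suc p) (term a))   ≡⟨ ∑<-single {f = λ a → ∑< (suc p) (term a)} (s≤s (a≤⟨a,b⟩ a b)) outer ⟩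
    ∑< (suc p) (term a)                      ≡⟨ ∑<-single {f = term a} (s≤s (b≤⟨a,b⟩ a b)) (proj₂ ∘ position) ⟩
    equals p p * σ a b                       ≡⟨ cong (_* σ a b) (equals-refl p) ⟩
    1 * σ a b                                ≡⟨ *-identityˡ (σ a b) ⟩
    σ a b                                    ∎
    where
    open ≡-Reasoning
    p : ℕ
    p = ⟨ a , b ⟩
    term : ℕ → ℕ → ℕ
    term a b = equals ⟨ a , b ⟩ p * σ a b
    position : ∀ {a′ b′} → term a′ b′ ≢ 0 → a′ ≡ a × b′ ≡ b
    position {a′} {b′} ≢0 = ⟨⟩-injective (equals⇒≡ (m*n≢0⁻ˡ (equals ⟨ a′ , b′ ⟩ p) (σ a′ b′) ≢0))
    outer : ∀ {a′} → ∑< (suc p) (term a′) ≢ 0 → a′ ≡ a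
    outer {a′} ≢0 with ∑<-nonzero⁻ (suc p) {term a′} ≢0
    ... | b′ , _ , ≢0′ = proj₁ (position ≢0′)

  decode≢0⇒pair : ∀ σ p → decode σ p ≢ 0 → ∃₂ λ a b → ⟨ a , b ⟩ ≡ p
  decode≢0⇒pair σ p ≢0 with ∑<-nonzero⁻ (suc p) {λ a → ∑< (suc p) λ b → equals ⟨ a , b ⟩ p * σ a b} ≢0
  ... | a , _ , ≢0′ with ∑<-nonzero⁻ (suc p) {λ b → equals ⟨ a , b ⟩ p * σ a b} ≢0′
  ...   | b , _ , ≢0″ = a , b , equals⇒≡ (m*n≢0⁻ˡ (equals ⟨ a , b ⟩ p) (σ a b) ≢0″)

opaque

  π₁ π₂ : ℕ → ℕ
  π₁ = decode λ a b → a
  π₂ = decode λ a b → b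

  π₁-⟨⟩ : ∀ a b → π₁ ⟨ a , b ⟩ ≡ a
  π₁-⟨⟩ = decode-⟨⟩ λ a b → a

  π₂-⟨⟩ : ∀ a b → π₂ ⟨ a , b ⟩ ≡ b
  π₂-⟨⟩ = decode-⟨⟩ λ a b → b

  -- Numbers that are not pairs satisfy the bound too, since `decode` gives 0 there. The bound keeps
  -- the indices of a fold within the range that `expand` provides.
  π₁≤ : ∀ p → π₁ p ≤ p
  π₁≤ p with π₁ p ≟ 0
  ... | yes eq = subst (_≤ p) (sym eq) z≤n
  ... | no ≢0 with decode≢0⇒pair (λ a b → a) p ≢0
  ...   | a , b , refl = subst (_≤ ⟨ a , b ⟩) (sym (π₁-⟨⟩ a b)) (a≤⟨a,b⟩ a b)

-- Finite sets coded in binary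

opaque

  bit : ℕ → ℕ → ℕ
  bit zero    S = S % 2
  bit (suc t) S = bit t (S / 2)

infix 4 _∈_
_∈_ : ℕ → ℕ → Set
t ∈ S = bit t S ≢ 0

opaque
  unfolding bit

  bit≤1 : ∀ t S → bit t S ≤ 1
  bit≤1 zero    S = s≤s⁻¹ (m%n<n S 2)
  bit≤1 (suc t) S = bit≤1 t (S / 2)

  ∈⇒bit≡1 : ∀ {t S} → t ∈ S → bit t S ≡ 1
  ∈⇒bit≡1 {t} {S} t∈S = ≤-antisym (bit≤1 t S) (n≢0⇒n>0 t∈S)

  ∉0 : ∀ t → bit t 0 ≡ 0
  ∉0 zero    = refl
  ∉0 (suc t) = ∉0 t

  ∈⇒< : ∀ {t S} → t ∈ S → t < S
  ∈⇒< {t}     {zero}    t∈S = contradiction (∉0 t) t∈S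
  ∈⇒< {zero}  {suc S}   t∈S = z<s
  ∈⇒< {suc t} {S@(suc _)} t∈S = <-≤-trans (s<s (∈⇒< {t} t∈S)) (m/n<m S 2 ≤-refl)

  -- The digits of this number are the values of `χ` only when these are at most 1; larger values
  -- would cause carries.
  bits : ℕ → (ℕ → ℕ) → ℕ
  bits B χ = ∑< B λ t → 2 ^ t * χ t

  -- Horner's form, which matches the recursion of `bit` by halving.
  bits-suc : ∀ B χ → bits (suc B) χ ≡ χ 0 + bits B (χ ∘ suc) * 2
  bits-suc B χ = cong₂ _+_ (*-identityˡ (χ 0)) (shift B (λ t → 2 ^ t) (χ ∘ suc))
    where
    -- The weight `w` is arbitrary because the induction passes to `w ∘ suc`.
    shift : ∀ B (w χ : ℕ → ℕ) → ∑< B (λ t → 2 * w t * χ t) ≡ ∑< B (λ t → w t * χ t) * 2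
    shift zero    w χ = refl
    shift (suc B) w χ = begin
      2 * w 0 * χ 0 + ∑< B (λ t → 2 * w (suc t) * χ (suc t))
        ≡⟨ cong₂ _+_ (trans (*-assoc 2 (w 0) (χ 0)) (*-comm 2 (w 0 * χ 0))) (shift B (w ∘ suc) (χ ∘ suc)) ⟩
      w 0 * χ 0 * 2 + ∑< B (λ t → w (suc t) * χ (suc t)) * 2
        ≡⟨ *-distribʳ-+ 2 (w 0 * χ 0) _ ⟨
      (w 0 * χ 0 + ∑< B (λ t → w (suc t) * χ (suc t))) * 2 ∎
      where open ≡-Reasoning

  bit-suc-bits : ∀ t B {χ} → (∀ t → χ t ≤ 1) → bit (suc t) (bits (suc B) χ) ≡ bit t (bits B (χ ∘ suc))
  bit-suc-bits t B {χ} χ≤1 = cong (bit t) (begin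
    bits (suc B) χ / 2       ≡⟨ cong (_/ 2) (bits-suc B χ) ⟩
    (χ 0 + c * 2) / 2        ≡⟨ +-distrib-/ (χ 0) (c * 2) small ⟩
    χ 0 / 2 + c * 2 / 2      ≡⟨ cong₂ _+_ (m<n⇒m/n≡0 (s≤s (χ≤1 0))) (m*n/n≡m c 2) ⟩
    c                        ∎)
    where
    open ≡-Reasoning
    c : ℕ
    c = bits B (χ ∘ suc)
    -- There is no carry: the second summand has remainder 0, so halving distributes over the sum.
    small : χ 0 % 2 + c * 2 % 2 < 2
    small = subst (_< 2) (sym (trans (cong (χ 0 % 2 +_) (m*n%n≡0 c 2)) (+-identityʳ _))) (m%n<n (χ 0) 2)

  bit-bits : ∀ {t B χ} → t < B → (∀ t → χ t ≤ 1) → bit t (bits B χ) ≡ χ t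
  bit-bits {zero} {suc B} {χ} _ χ≤1 = begin
    bits (suc B) χ % 2                 ≡⟨ cong (_% 2) (bits-suc B χ) ⟩
    (χ 0 + bits B (χ ∘ suc) * 2) % 2   ≡⟨ [m+kn]%n≡m%n (χ 0) (bits B (χ ∘ suc)) 2 ⟩
    χ 0 % 2                            ≡⟨ m<n⇒m%n≡m (s≤s (χ≤1 0)) ⟩
    χ 0                                ∎
    where open ≡-Reasoning
  bit-bits {suc t} {suc B} t<B χ≤1 =
    trans (bit-suc-bits t B χ≤1) (bit-bits (s<s⁻¹ t<B) (χ≤1 ∘ suc))

  bit-bits-≥ : ∀ {t B χ} → B ≤ t → (∀ t → χ t ≤ 1) → bit t (bits B χ) ≡ 0
  bit-bits-≥ {t}     {zero}  _   _   = ∉0 t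
  bit-bits-≥ {suc t} {suc B} B≤t χ≤1 =
    trans (bit-suc-bits t B χ≤1) (bit-bits-≥ (s≤s⁻¹ B≤t) (χ≤1 ∘ suc))

-- Division and binary digits by bounded sums.

opaque

  -- For nonzero `d` this counts the positive multiples of `d` up to `m`; at most `m` of them exist,
  -- so the range `z < m` suffices.
  quotient : ℕ → ℕ → ℕ
  quotient m d = ∑< m λ z → leq (suc z * d) m

  quotient≡/ : ∀ m d .{{_ : NonZero d}} → quotient m d ≡ m / d
  quotient≡/ m d = ∑<-initial-segment (m/n≤m m d)
    (λ z<m/d → leq-true (≮⇒≥ λ m<sz*d → <⇒≱ z<m/d (s≤s⁻¹ (m<n*o⇒m/o<n m<sz*d))))
    (λ {z} m/d≤z → leq-false (begin-strict
      m                    ≡⟨ m≡m%n+[m/n]*n m d ⟩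
      m % d + m / d * d    <⟨ +-monoˡ-< (m / d * d) (m%n<n m d) ⟩
      suc (m / d) * d      ≤⟨ *-monoˡ-≤ d (s≤s m/d≤z) ⟩
      suc z * d            ∎))
    where open ≤-Reasoning

opaque
  unfolding bit

  -- `bit` is defined by recursion, which is not an elementary closure rule. The digit is therefore
  -- written as the remainder modulo 2 of the quotient of `S` by `2 ^ t`.
  bit-arithmetic : ∀ t S → quotient S (2 ^ t) ∸ quotient (quotient S (2 ^ t)) 2 * 2 ≡ bit t S
  bit-arithmetic t S rewrite quotient≡/ S (2 ^ t) {{m^n≢0 2 t}}
                           | quotient≡/ (_/_ S (2 ^ t) {{m^n≢0 2 t}}) 2 {{_}} =
    trans (sym (m%n≡m∸m/n*n (_/_ S (2 ^ t) {{m^n≢0 2 t}}) 2)) (shift t S)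
    where
    shift : ∀ t S → _/_ S (2 ^ t) {{m^n≢0 2 t}} % 2 ≡ bit t S
    shift zero    S = cong (_% 2) (n/1≡n S)
    shift (suc t) S = trans
      (cong (_% 2) (sym (m/n/o≡m/[n*o] S 2 (2 ^ t) {{_}} {{m^n≢0 2 t}} {{m^n≢0 2 (suc t)}})))
      (shift t (S / 2))

-- A generalised image: row s of S yields the rows h s z S for all z < S.
opaque

  imageBound : (ℕ → ℕ → ℕ → ℕ) → ℕ → ℕ
  imageBound h S = suc (∑< S λ s → ∑< S λ z → h s z S)

  imageCount : (ℕ → ℕ → ℕ → ℕ) → ℕ → ℕ → ℕ
  imageCount h S t = ∑< S λ s → ∑< S λ z → bit s S * equals t (h s z S)

  image : (ℕ → ℕ → ℕ → ℕ) → ℕ → ℕ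
  image h S = bits (imageBound h S) (sign ∘ imageCount h S)

  image-complete : ∀ h {s z S} → s ∈ S → z < S → h s z S ∈ image h S
  image-complete h {s} {z} {S} s∈S z<S eq = count≢0 (trans (sym (bit-bits bounded (sign≤1 ∘ imageCount h S))) eq)
    where
    t : ℕ
    t = h s z S
    -- The bound exceeds the sum of all candidate rows, hence each of them, so no row is cut off.
    bounded : h s z S < imageBound h S
    bounded = s≤s (≤-trans (term≤∑< (λ z → h s z S) z<S) (term≤∑< (λ s → ∑< S λ z → h s z S) (∈⇒< s∈S)))
    count≢0 : sign (imageCount h S t) ≢ 0
    count≢0 = sign≢0⁺ {imageCount h S t}
      (∑<-nonzero⁺ {f = λ s′ → ∑< S λ z′ → bit s′ S * equals t (h s′ z′ S)} (∈⇒< s∈S)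
      (∑<-nonzero⁺ {f = λ z′ → bit s S * equals t (h s z′ S)} z<S (m*n≢0⁺ (bit s S) (equals t t) s∈S (≡⇒equals {t} refl))))

  image-sound : ∀ h {t S} → t ∈ image h S → ∃₂ λ s z → s ∈ S × z < S × t ≡ h s z S
  image-sound h {t} {S} t∈ with t <? imageBound h S
  ... | no t≮ = contradiction (bit-bits-≥ {t} (≮⇒≥ t≮) (sign≤1 ∘ imageCount h S)) t∈
  ... | yes t< with ∑<-nonzero⁻ S {λ s → ∑< S λ z → bit s S * equals t (h s z S)}
                      (sign≢0⁻ {imageCount h S t} (subst (_≢ 0) (bit-bits t< (sign≤1 ∘ imageCount h S)) t∈))
  ...   | s , _ , ≢0 with ∑<-nonzero⁻ S {λ z → bit s S * equals t (h s z S)} ≢0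
  ...     | z , z<S , ≢0′ = s , z , m*n≢0⁻ˡ (bit s S) (equals t (h s z S)) ≢0′ , z<S ,
                          equals⇒≡ (m*n≢0⁻ʳ (bit s S) (equals t (h s z S)) ≢0′)

opaque

  -- Meaningful only if exactly one row of T has second component r.
  valueAt : ℕ → ℕ → ℕ
  valueAt T r = ∑< T λ t → bit t T * equals (π₂ t) r * π₁ t

  valueAt-unique : ∀ {T v r} → ⟨ v , r ⟩ ∈ T → (∀ {t} → t ∈ T → π₂ t ≡ r → t ≡ ⟨ v , r ⟩) →
                   valueAt T r ≡ v
  valueAt-unique {T} {v} {r} p∈T unique = begin
    valueAt T r
      ≡⟨ ∑<-single {f = λ t → hit t * π₁ t} (∈⇒< p∈T) (λ {t} ≢0 →
           let hit≢0 = m*n≢0⁻ˡ (hit t) (π₁ t) ≢0 in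
           unique {t} (m*n≢0⁻ˡ (bit t T) _ hit≢0) (equals⇒≡ (m*n≢0⁻ʳ (bit t T) _ hit≢0))) ⟩
    bit p T * equals (π₂ p) r * π₁ p
      ≡⟨ cong₂ _*_ (cong₂ _*_ (∈⇒bit≡1 {p} p∈T) (trans (cong (λ q → equals q r) (π₂-⟨⟩ v r)) (equals-refl r)))
                   (π₁-⟨⟩ v r) ⟩
    1 * 1 * v    ≡⟨ *-identityˡ v ⟩
    v            ∎
    where
    open ≡-Reasoning
    p : ℕ
    p = ⟨ v , r ⟩
    hit : ℕ → ℕ
    hit t = bit t T * equals (π₂ t) r

opaque
  unfolding bit

  2^suc/2 : ∀ p → 2 ^ suc p / 2 ≡ 2 ^ p
  2^suc/2 p = trans (cong (_/ 2) (*-comm 2 (2 ^ p))) (m*n/n≡m (2 ^ p) 2)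

  -- In the binary coding `2 ^ p` is the singleton of `p`; this and `∈2^` describe the set on which
  -- a program starts.
  bit-2^ : ∀ p → bit p (2 ^ p) ≡ 1
  bit-2^ zero    = refl
  bit-2^ (suc p) = trans (cong (bit p) (2^suc/2 p)) (bit-2^ p)

  ∈2^ : ∀ t p → t ∈ 2 ^ p → t ≡ p
  ∈2^ zero    zero    _  = refl
  ∈2^ zero    (suc p) t∈ = contradiction (trans (cong (_% 2) (*-comm 2 (2 ^ p))) (m*n%n≡0 (2 ^ p) 2)) t∈
  ∈2^ (suc t) zero    t∈ = contradiction (∉0 t) t∈
  ∈2^ (suc t) (suc p) t∈ = cong suc (∈2^ t p (subst (t ∈_) (2^suc/2 p) t∈))

-- Elementarity of the generators

-- Arguments are read by `lookup`, as in `projection`, so that derivations built from `v₀`, `v₁`,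
-- `v₂` fit definitionally.
Unary : (ℕ → ℕ) → Set
Unary g = KalmárElementary 0 λ xs → g (lookup xs 0F)

Binary : (ℕ → ℕ → ℕ) → Set
Binary g = KalmárElementary 1 λ xs → g (lookup xs 0F) (lookup xs 1F)

Ternary : (ℕ → ℕ → ℕ → ℕ) → Set
Ternary g = KalmárElementary 2 λ xs → g (lookup xs 0F) (lookup xs 1F) (lookup xs 2F)

-- Closure at every arity lets an elementarity proof copy the defining expression symbol by symbol.
Preserves₁ : (ℕ → ℕ) → Set
Preserves₁ g = ∀ {n f} → KalmárElementary n f → KalmárElementary n (λ xs → g (f xs))

Preserves₂ : (ℕ → ℕ → ℕ) → Set
Preserves₂ g = ∀ {n f₀ f₁} → KalmárElementary n f₀ → KalmárElementary n f₁ →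
               KalmárElementary n (λ xs → g (f₀ xs) (f₁ xs))

Preserves₃ : (ℕ → ℕ → ℕ → ℕ) → Set
Preserves₃ g = ∀ {n f₀ f₁ f₂} → KalmárElementary n f₀ → KalmárElementary n f₁ → KalmárElementary n f₂ →
               KalmárElementary n (λ xs → g (f₀ xs) (f₁ xs) (f₂ xs))

preserves₁ : ∀ {g} → Unary g → Preserves₁ g
preserves₁ kg kf = substitution kg (const kf)

preserves₂ : ∀ {g} → Binary g → Preserves₂ g
preserves₂ kg {f₀ = f₀} {f₁} k₀ k₁ =
  substitution {g = λ { 0F → f₀ ; 1F → f₁ }} kg λ { 0F → k₀ ; 1F → k₁ }

preserves₃ : ∀ {g} → Ternary g → Preserves₃ g
preserves₃ kg {f₀ = f₀} {f₁} {f₂} k₀ k₁ k₂ =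
  substitution {g = λ { 0F → f₀ ; 1F → f₁ ; 2F → f₂ }} kg λ { 0F → k₀ ; 1F → k₁ ; 2F → k₂ }

lookup-last : ∀ {n} (xs : Vec ℕ (suc n)) → lookup xs (fromℕ n) ≡ last xs
lookup-last {zero}  (x ∷ []) = refl
lookup-last {suc n} (x ∷ xs) = lookup-last xs

lookup-inject₁ : ∀ {n} (xs : Vec ℕ (suc n)) i → lookup xs (inject₁ i) ≡ lookup (init xs) i
lookup-inject₁ {suc n} (x ∷ xs) zero    = refl
lookup-inject₁ {suc n} (x ∷ xs) (suc i) = lookup-inject₁ xs i

-- Bounded operators with the bound variable moved to the front, so that
-- variables behave as de Bruijn indices.
module _ (fold : ℕ → (ℕ → ℕ) → ℕ)
         (fold-cong : ∀ n {f g : ℕ → ℕ} → f ≗ g → fold n f ≡ fold n g)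
         (closed : ∀ {n} {f : Op (suc n)} → KalmárElementary n f →
                   KalmárElementary n (λ xsy → fold (last xsy) (λ z → f (init xsy ∷ʳ z)))) where

  fold-elementary : ∀ {n b f} → KalmárElementary n b → KalmárElementary (suc n) f →
                    KalmárElementary n (λ xs → fold (b xs) (λ z → f (z ∷ xs)))
  fold-elementary {n} {b} {f} kb kf = ext unfold
    (substitution (closed rotated)
      (▷-all (KalmárElementary n) {gs = λ i xs → lookup xs i} projection kb))
    where
    -- The closure rules bind the last argument while `f` binds its first; `rotation` moves the last
    -- entry to the front.
    rotation : Fin (suc (suc n)) → Op (suc (suc n))
    rotation zero    ws = lookup ws (fromℕ (suc n))
    rotation (suc i) ws = lookup ws (inject₁ i)

    rotated : KalmárElementary (suc n) (substitute f rotation)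
    rotated = substitution {g = rotation} kf λ { zero → projection (fromℕ (suc n)) ; (suc i) → projection (inject₁ i) }

    rotate : ∀ xs z → tabulate (λ i → rotation i (xs ∷ʳ z)) ≡ z ∷ xs
    rotate xs z = cong₂ _∷_ (trans (lookup-last (xs ∷ʳ z)) (last-∷ʳ z xs))
      (trans (tabulate-cong (λ i → trans (lookup-inject₁ (xs ∷ʳ z) i) (cong (λ ys → lookup ys i) (init-∷ʳ z xs))))
             (tabulate∘lookup xs))

    unfold : ∀ xs → _ ≡ fold (b xs) (λ z → f (z ∷ xs))
    unfold xs = trans
      (cong (λ ws → fold (last ws) (λ z → substitute f rotation (init ws ∷ʳ z)))
        (trans (tabulate-▷ (λ i ys → lookup ys i) b xs) (cong (_∷ʳ b xs) (tabulate∘lookup xs))))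
      (trans (cong₂ (λ y ws → fold y (λ z → substitute f rotation (ws ∷ʳ z))) (last-∷ʳ (b xs) xs) (init-∷ʳ (b xs) xs))
             (fold-cong (b xs) (λ z → cong f (rotate xs z))))

∑-elementary : ∀ {n b f} → KalmárElementary n b → KalmárElementary (suc n) f →
               KalmárElementary n (λ xs → ∑< (b xs) (λ z → f (z ∷ xs)))
∑-elementary = fold-elementary ∑< (λ n eq → cong sum (applyUpTo-cong-< n (λ {i} _ → eq i))) summation

∏-elementary : ∀ {n b f} → KalmárElementary n b → KalmárElementary (suc n) f →
               KalmárElementary n (λ xs → ∏< (b xs) (λ z → f (z ∷ xs)))
∏-elementary = fold-elementary ∏< (λ n eq → cong product (applyUpTo-cong-< n (λ {i} _ → eq i))) multiplication

v₀ : KalmárElementary n (λ xs → lookup xs zero)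
v₀ = projection zero

v₁ : KalmárElementary (suc n) (λ xs → lookup xs (suc zero))
v₁ = projection (suc zero)

v₂ : KalmárElementary (suc (suc n)) (λ xs → lookup xs (suc (suc zero)))
v₂ = projection (suc (suc zero))

v₃ : KalmárElementary (suc (suc (suc n))) (λ xs → lookup xs (suc (suc (suc zero))))
v₃ = projection (suc (suc (suc zero)))

infixl 6 _+ᴷ_ _∸ᴷ_
infixl 7 _*ᴷ_

_+ᴷ_ : Preserves₂ _+_
_+ᴷ_ = preserves₂ (ext (λ { (x ∷ y ∷ []) → refl }) addition)

_∸ᴷ_ : Preserves₂ _∸_
_∸ᴷ_ = preserves₂ (ext (λ { (x ∷ y ∷ []) → refl }) monus)

_*ᴷ_ : Preserves₂ _*_
_*ᴷ_ = preserves₂ (ext (λ { (x ∷ y ∷ []) → ∑<-const x y }) (∑-elementary v₀ v₂))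

sucᴷ : Preserves₁ suc
sucᴷ = constant 1 +ᴷ_

2^ᴷ : Preserves₁ (2 ^_)
2^ᴷ = preserves₁ (ext (λ { (x ∷ []) → ∏<-const x 2 }) (∏-elementary v₀ (constant 2)))

opaque
  unfolding leq

  leqᴷ : Preserves₂ leq
  leqᴷ kf kg = constant 1 ∸ᴷ (kf ∸ᴷ kg)

opaque
  unfolding sign

  signᴷ : Preserves₁ sign
  signᴷ kf = constant 1 ∸ᴷ (constant 1 ∸ᴷ kf)

opaque
  unfolding equals

  equalsᴷ : Preserves₂ equals
  equalsᴷ kf kg = leqᴷ kf kg *ᴷ leqᴷ kg kf

opaque
  unfolding ⟨_,_⟩

  ⟨_,_⟩ᴷ : Preserves₂ ⟨_,_⟩
  ⟨ kf , kg ⟩ᴷ = (kf +ᴷ kg) *ᴷ (kf +ᴷ kg) +ᴷ kf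

opaque
  unfolding decode

  decodeᴷ : ∀ {σ} → Preserves₂ σ → Preserves₁ (decode σ)
  decodeᴷ {σ} σᴷ = preserves₁ {decode σ}
    (∑-elementary (sucᴷ v₀) (∑-elementary (sucᴷ v₁) (equalsᴷ ⟨ v₁ , v₀ ⟩ᴷ v₂ *ᴷ σᴷ v₁ v₀)))

opaque
  unfolding π₁

  π₁ᴷ : Preserves₁ π₁
  π₁ᴷ = decodeᴷ λ ka kb → ka

  π₂ᴷ : Preserves₁ π₂
  π₂ᴷ = decodeᴷ λ ka kb → kb

opaque
  unfolding quotient

  quotientᴷ : Preserves₂ quotient
  quotientᴷ = preserves₂ {quotient} (∑-elementary v₀ (leqᴷ (sucᴷ v₀ *ᴷ v₂) v₁))

bitᴷ : Preserves₂ bit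
bitᴷ = preserves₂ {bit} (ext (λ xs → bit-arithmetic (lookup xs 0F) (lookup xs 1F))
                       (shifted ∸ᴷ quotientᴷ shifted (constant 2) *ᴷ constant 2))
  where
  shifted : Binary (λ t S → quotient S (2 ^ t))
  shifted = quotientᴷ v₁ (2^ᴷ v₀)

opaque
  unfolding bits image

  image-unary : ∀ {h} → Preserves₃ h → Unary (image h)
  image-unary hᴷ = ∑-elementary
    (sucᴷ (∑-elementary v₀ (∑-elementary v₁ (hᴷ v₁ v₀ v₂))))
    (2^ᴷ v₀ *ᴷ signᴷ (∑-elementary v₁ (∑-elementary v₂ (bitᴷ v₁ v₃ *ᴷ equalsᴷ v₂ (hᴷ v₁ v₀ v₃)))))

opaque
  unfolding valueAt

  valueAtᴷ : Preserves₂ valueAt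
  valueAtᴷ = preserves₂ {valueAt} (∑-elementary v₀ (bitᴷ v₀ v₁ *ᴷ equalsᴷ (π₂ᴷ v₀) v₂ *ᴷ π₁ᴷ v₀))

-- Rows and the generators

act : (ℕ → ℕ) → ℕ → ℕ
act φ s = ⟨ φ (π₁ s) , π₂ s ⟩

-- The moves for pairing φ a with ψ a: `duplicate` saves the row while φ a is computed, `swap`
-- stores φ a and restores a, and `join` pairs φ a with the ψ a computed next.
duplicate swap join : ℕ → ℕ
duplicate s = ⟨ π₁ s , s ⟩
swap s = ⟨ π₁ (π₂ s) , ⟨ π₁ s , π₂ (π₂ s) ⟩ ⟩
join s = ⟨ ⟨ π₁ (π₂ s) , π₁ s ⟩ , π₂ (π₂ s) ⟩

mapRows : (ℕ → ℕ) → ℕ → ℕ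
mapRows g = image λ s _ _ → g s

-- `act id` is listed because it differs from the identity at numbers that are not pairs.
rowInstructions : List (ℕ → ℕ)
rowInstructions =
  duplicate ∷ swap ∷ join ∷ act id ∷ act π₁ ∷ act π₂ ∷ act (const 0) ∷ act suc ∷
  act (λ p → π₁ p + π₂ p) ∷ act (λ p → π₁ p ∸ π₂ p) ∷ []

-- The second component ⟨ z , s ⟩ records the index and the whole original row, so that
-- reducedRow can find the value at z again.  All z < S are used rather than all
-- z < π₁ (π₁ s): this suffices since π₁ (π₁ s) ≤ s < S, and it keeps s represented
-- when the sum or product is empty.
expandedRow : ℕ → ℕ → ℕ
expandedRow s z = ⟨ ⟨ z , π₂ (π₁ s) ⟩ , ⟨ z , s ⟩ ⟩

expand : ℕ → ℕ
expand = image λ s z _ → expandedRow s z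

reducedRow : (ℕ → (ℕ → ℕ) → ℕ) → ℕ → ℕ → ℕ
reducedRow fold s T = ⟨ fold (π₁ (π₁ s)) (λ z → valueAt T ⟨ z , s ⟩) , π₂ s ⟩

-- A descendant of the row s has the form ⟨ v , ⟨ z , s ⟩ ⟩, so `π₂ (π₂ t)` recovers s. All
-- descendants of s yield the same row and merge in the resulting set.
reduce : (ℕ → (ℕ → ℕ) → ℕ) → ℕ → ℕ
reduce fold = image λ t _ T → reducedRow fold (π₂ (π₂ t)) T

input output : ℕ → ℕ
input x = 2 ^ ⟨ x , 0 ⟩
output S = valueAt S 0

basis : List (ℕ → ℕ)
basis = input ∷ output ∷ expand ∷ reduce ∑< ∷ reduce ∏< ∷ List.map mapRows rowInstructions

-- From the closure of the basis to elementary functions.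

act-unary : ∀ φ → Preserves₁ φ → Unary (act φ)
act-unary φ φᴷ = ⟨ φᴷ (π₁ᴷ v₀) , π₂ᴷ v₀ ⟩ᴷ

mapRows-unary : ∀ g → Unary g → Unary (mapRows g)
mapRows-unary g kg = image-unary (λ ks _ _ → preserves₁ {g} kg ks)

expand-unary : Unary expand
expand-unary = image-unary (λ ks kz _ → ⟨ ⟨ kz , π₂ᴷ (π₁ᴷ ks) ⟩ᴷ , ⟨ kz , ks ⟩ᴷ ⟩ᴷ)

module _ {fold : ℕ → (ℕ → ℕ) → ℕ}
         (closed : ∀ {n b f} → KalmárElementary n b → KalmárElementary (suc n) f →
                   KalmárElementary n (λ xs → fold (b xs) (λ z → f (z ∷ xs)))) where

  reduce-unary : Unary (reduce fold)
  reduce-unary = image-unary (preserves₃ {λ t _ T → reducedRow fold (π₂ (π₂ t)) T}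
    -- In the bound the row t is `v₀`; under the binder z is `v₀`, t is `v₁` and the set T is `v₃`.
    ⟨ closed (π₁ᴷ (π₁ᴷ (π₂ᴷ (π₂ᴷ v₀)))) (valueAtᴷ v₃ ⟨ v₀ , π₂ᴷ (π₂ᴷ v₁) ⟩ᴷ) , π₂ᴷ (π₂ᴷ (π₂ᴷ v₀)) ⟩ᴷ)

rowInstructions-unary : All Unary rowInstructions
rowInstructions-unary =
  ⟨ π₁ᴷ v₀ , v₀ ⟩ᴷ ∷
  ⟨ π₁ᴷ (π₂ᴷ v₀) , ⟨ π₁ᴷ v₀ , π₂ᴷ (π₂ᴷ v₀) ⟩ᴷ ⟩ᴷ ∷
  ⟨ ⟨ π₁ᴷ (π₂ᴷ v₀) , π₁ᴷ v₀ ⟩ᴷ , π₂ᴷ (π₂ᴷ v₀) ⟩ᴷ ∷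
  act-unary id id ∷
  act-unary π₁ π₁ᴷ ∷
  act-unary π₂ π₂ᴷ ∷
  act-unary (const 0) (const (constant 0)) ∷
  act-unary suc sucᴷ ∷
  act-unary (λ p → π₁ p + π₂ p) (λ kp → π₁ᴷ kp +ᴷ π₂ᴷ kp) ∷
  act-unary (λ p → π₁ p ∸ π₂ p) (λ kp → π₁ᴷ kp ∸ᴷ π₂ᴷ kp) ∷ []

basis-unary : All Unary basis
basis-unary =
  2^ᴷ ⟨ v₀ , constant 0 ⟩ᴷ ∷
  valueAtᴷ v₀ (constant 0) ∷
  expand-unary ∷
  reduce-unary {∑<} ∑-elementary ∷
  reduce-unary {∏<} ∏-elementary ∷
  All.map⁺ {f = mapRows} (All.map (λ {g} → mapRows-unary g) rowInstructions-unary)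

unary⇒elementary : ∀ f → Unary f → UnaryKalmárElementary f
unary⇒elementary f = ext λ { (x ∷ []) → refl }

closure⇒elementary : ∀ {f} → SubstitutionClosure basis f → UnaryKalmárElementary f
closure⇒elementary {f} (generator f∈) = unary⇒elementary f (All.lookup basis-unary f∈)
closure⇒elementary (constant c)   = constant c
closure⇒elementary identity       = unary⇒elementary id v₀
closure⇒elementary (composition f g) = substitution (closure⇒elementary f) (const (closure⇒elementary g))
closure⇒elementary (ext f≗g f)    = ext (f≗g ∘ head) (closure⇒elementary f)

-- Realisability by programs

-- `run` has to act correctly on all finite sets of rows; this uniformity lets a single run evaluate
-- every term of a bounded sum or product.
record Program (g : ℕ → ℕ) : Set where
  field
    run      : ℕ → ℕ
    closed   : SubstitutionClosure basis run
    complete : ∀ {s S} → s ∈ S → g s ∈ run S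
    sound    : ∀ {t S} → t ∈ run S → ∃[ s ] s ∈ S × t ≡ g s

open Program

infixr 9 _⊙_
_⊙_ : ∀ {g h} → Program g → Program h → Program (g ∘ h)
(P ⊙ Q) .run      = run P ∘ run Q
(P ⊙ Q) .closed   = composition (closed P) (closed Q)
(P ⊙ Q) .complete = complete P ∘ complete Q
_⊙_ {g} P Q .sound t∈ with sound P t∈
... | u , u∈ , t≡ with sound Q u∈
...   | s , s∈ , u≡ = s , s∈ , trans t≡ (cong g u≡)

program-ext : ∀ {g h} → g ≗ h → Program g → Program h
program-ext eq P .run      = run P
program-ext eq P .closed   = closed P
program-ext eq P .complete {s} {S} s∈ = subst (_∈ run P S) (eq s) (complete P s∈)
program-ext eq P .sound t∈ with sound P t∈
... | s , s∈ , t≡ = s , s∈ , trans t≡ (eq s)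

instruction : ∀ {g} → g List.∈ rowInstructions → Program g
instruction {g} _  .run = mapRows g
instruction g∈ .closed = generator (there (there (there (there (there (List.∈-map⁺ mapRows g∈))))))
-- The dummy index 0 is below `S` because a set with an element has a nonzero code.
instruction {g} _ .complete {s} {S} s∈ = image-complete (λ s _ _ → g s) {z = 0} s∈ (≤-trans z<s (∈⇒< {s} s∈))
instruction {g} _ .sound t∈ with image-sound (λ s _ _ → g s) t∈
... | s , _ , s∈ , _ , t≡ = s , s∈ , t≡

Realizable : (ℕ → ℕ) → Set
Realizable φ = Program (act φ)

realizable-ext : ∀ {φ ψ} → φ ≗ ψ → Realizable φ → Realizable ψ
realizable-ext eq = program-ext λ s → cong (λ v → ⟨ v , π₂ s ⟩) (eq (π₁ s))

realizable-∘ : ∀ {φ ψ} → Realizable φ → Realizable ψ → Realizable (φ ∘ ψ)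
realizable-∘ {φ} {ψ} P Q = program-ext
  (λ s → cong₂ (λ a r → ⟨ φ a , r ⟩) (π₁-⟨⟩ (ψ (π₁ s)) (π₂ s)) (π₂-⟨⟩ (ψ (π₁ s)) (π₂ s)))
  (P ⊙ Q)

realizable-id : Realizable id
realizable-id = instruction (there (there (there (here refl))))

realizable-π₁ : Realizable π₁
realizable-π₁ = instruction (there (there (there (there (here refl)))))

realizable-π₂ : Realizable π₂
realizable-π₂ = instruction (there (there (there (there (there (here refl))))))

-- A finite basis cannot list `act (const c)` for every `c`, and the constants of
-- `SubstitutionClosure` act on codes of sets, not on rows.
realizable-const : ∀ c → Realizable (const c)
realizable-const zero    = instruction (there (there (there (there (there (there (here refl)))))))
realizable-const (suc c) = realizable-∘
  (instruction (there (there (there (there (there (there (there (here refl))))))))) (realizable-const c)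

realizable-+ : Realizable (λ p → π₁ p + π₂ p)
realizable-+ = instruction (there (there (there (there (there (there (there (there (here refl)))))))))

realizable-∸ : Realizable (λ p → π₁ p ∸ π₂ p)
realizable-∸ = instruction (there (there (there (there (there (there (there (there (there (here refl))))))))))

-- The program for `ψ` leaves second components unchanged, so the value of `φ` can wait there.
realizable-⟨⟩ : ∀ {φ ψ} → Realizable φ → Realizable ψ → Realizable (λ a → ⟨ φ a , ψ a ⟩)
realizable-⟨⟩ {φ} {ψ} P Q = program-ext correct
  (instruction (there (there (here refl))) ⊙ Q ⊙ instruction (there (here refl)) ⊙ P ⊙ instruction (here refl))
  where
  act-⟨⟩ : ∀ φ a r → act φ ⟨ a , r ⟩ ≡ ⟨ φ a , r ⟩
  act-⟨⟩ φ a r = cong₂ (λ a r → ⟨ φ a , r ⟩) (π₁-⟨⟩ a r) (π₂-⟨⟩ a r)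
  swap-⟨⟩ : ∀ u s → swap ⟨ u , s ⟩ ≡ ⟨ π₁ s , ⟨ u , π₂ s ⟩ ⟩
  swap-⟨⟩ u s = cong₂ (λ u s → ⟨ π₁ s , ⟨ u , π₂ s ⟩ ⟩) (π₁-⟨⟩ u s) (π₂-⟨⟩ u s)
  join-⟨⟩ : ∀ v u r → join ⟨ v , ⟨ u , r ⟩ ⟩ ≡ ⟨ ⟨ u , v ⟩ , r ⟩
  join-⟨⟩ v u r rewrite π₁-⟨⟩ v ⟨ u , r ⟩ | π₂-⟨⟩ v ⟨ u , r ⟩ | π₁-⟨⟩ u r | π₂-⟨⟩ u r = refl
  correct : join ∘ act ψ ∘ swap ∘ act φ ∘ duplicate ≗ act (λ a → ⟨ φ a , ψ a ⟩)
  correct s = begin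
    join (act ψ (swap (act φ ⟨ a , s ⟩)))       ≡⟨ cong (join ∘ act ψ ∘ swap) (act-⟨⟩ φ a s) ⟩
    join (act ψ (swap ⟨ φ a , s ⟩))             ≡⟨ cong (join ∘ act ψ) (swap-⟨⟩ (φ a) s) ⟩
    join (act ψ ⟨ a , ⟨ φ a , π₂ s ⟩ ⟩)         ≡⟨ cong join (act-⟨⟩ ψ a _) ⟩
    join ⟨ ψ a , ⟨ φ a , π₂ s ⟩ ⟩               ≡⟨ join-⟨⟩ (ψ a) (φ a) (π₂ s) ⟩
    ⟨ ⟨ φ a , ψ a ⟩ , π₂ s ⟩                    ∎
    where
    open ≡-Reasoning
    a = π₁ s

-- Bounded operators on realizable functions.

module _ {fold : ℕ → (ℕ → ℕ) → ℕ}
         (fold-cong : ∀ n {f g : ℕ → ℕ} → (∀ {z} → z < n → f z ≡ g z) → fold n f ≡ fold n g)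
         (reduce∈ : SubstitutionClosure basis (reduce fold)) where

  realizable-fold : ∀ {φ} → Realizable φ → Realizable (λ p → fold (π₁ p) (λ z → φ ⟨ z , π₂ p ⟩))
  realizable-fold {φ} P = λ where
      .run      → reduce fold ∘ run P ∘ expand
      .closed   → composition reduce∈ (composition (closed P) (generator (there (there (here refl)))))
      .complete s∈ → complete-fold s∈
      .sound t∈ → sound-fold t∈
    where
    ψ : ℕ → ℕ
    ψ p = fold (π₁ p) (λ z → φ ⟨ z , π₂ p ⟩)

    T : ℕ → ℕ
    T S = run P (expand S)

    row : ℕ → ℕ → ℕ
    row s z = ⟨ φ ⟨ z , π₂ (π₁ s) ⟩ , ⟨ z , s ⟩ ⟩

    positive : ∀ {s S} → s ∈ S → 0 < S
    positive {s} s∈ = ≤-trans z<s (∈⇒< {s} s∈)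

    act-expandedRow : ∀ s z → act φ (expandedRow s z) ≡ row s z
    act-expandedRow s z = cong₂ (λ a r → ⟨ φ a , r ⟩) (π₁-⟨⟩ ⟨ z , π₂ (π₁ s) ⟩ ⟨ z , s ⟩) (π₂-⟨⟩ ⟨ z , π₂ (π₁ s) ⟩ ⟨ z , s ⟩)

    source : ∀ s z → π₂ (π₂ (row s z)) ≡ s
    source s z = trans (cong π₂ (π₂-⟨⟩ _ ⟨ z , s ⟩)) (π₂-⟨⟩ z s)

    row∈ : ∀ {s z S} → s ∈ S → z < S → row s z ∈ T S
    row∈ {s} {z} {S} s∈ z<S = subst (_∈ T S) (act-expandedRow s z)
      (complete P (image-complete (λ s z _ → expandedRow s z) s∈ z<S))

    row∈⁻ : ∀ {t S} → t ∈ T S → ∃₂ λ s z → s ∈ S × t ≡ row s z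
    row∈⁻ t∈ with sound P t∈
    ... | u , u∈ , refl with image-sound (λ s z _ → expandedRow s z) u∈
    ...   | s , z , s∈ , _ , refl = s , z , s∈ , act-expandedRow s z

    -- By injectivity of pairing the key ⟨ z , s ⟩ determines index and original row, and these
    -- determine the value; hence `valueAt` meets only one value per key.
    row-unique : ∀ {s z t S} → t ∈ T S → π₂ t ≡ ⟨ z , s ⟩ → t ≡ row s z
    row-unique {s} {z} t∈ eq with row∈⁻ t∈
    ... | s′ , z′ , _ , refl with ⟨⟩-injective {z′} {s′} (trans (sym (π₂-⟨⟩ _ ⟨ z′ , s′ ⟩)) eq)
    ...   | refl , refl = refl

    reduced : ∀ {s S} → s ∈ S → reducedRow fold s (T S) ≡ act ψ s
    reduced {s} {S} s∈ = cong (λ v → ⟨ v , π₂ s ⟩) (fold-cong (π₁ (π₁ s)) λ {z} z<y →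
      valueAt-unique (row∈ s∈ (<-≤-trans z<y (≤-trans (≤-trans (π₁≤ (π₁ s)) (π₁≤ s)) (<⇒≤ (∈⇒< s∈)))))
                     (λ {t} → row-unique {s} {z} {t}))

    complete-fold : ∀ {s S} → s ∈ S → act ψ s ∈ reduce fold (T S)
    complete-fold {s} {S} s∈ = subst (_∈ reduce fold (T S))
      (trans (cong (λ s → reducedRow fold s (T S)) (source s 0)) (reduced s∈))
      (image-complete (λ t _ T → reducedRow fold (π₂ (π₂ t)) T) {z = 0} row₀∈ (positive {row s 0} row₀∈))
      where
      -- Index 0 is always below `S`, so `s` has a descendant even if its fold is empty.
      row₀∈ : row s 0 ∈ T S
      row₀∈ = row∈ s∈ (positive {s} s∈)

    sound-fold : ∀ {t S} → t ∈ reduce fold (T S) → ∃[ s ] s ∈ S × t ≡ act ψ s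
    sound-fold {t} {S} t∈ with image-sound (λ t _ T → reducedRow fold (π₂ (π₂ t)) T) t∈
    ... | u , _ , u∈ , _ , refl with row∈⁻ u∈
    ...   | s , z , s∈ , refl = s , s∈ , trans (cong (λ s → reducedRow fold s (T S)) (source s z)) (reduced s∈)

  -- The body is run on pairs ⟨ z , a ⟩: `hs` reads the parameters from a through `π₂` and the bound
  -- variable through `π₁`.
  realizable-bounded : ∀ {f : Op (suc n)} →
    (∀ (gs : Fin (suc n) → ℕ → ℕ) → (∀ i → Realizable (gs i)) → Realizable (λ a → f (tabulate λ i → gs i a))) →
    ∀ (gs : Fin (suc n) → ℕ → ℕ) → (∀ i → Realizable (gs i)) →
    Realizable (λ a → fold (last (tabulate λ i → gs i a)) (λ z → f (init (tabulate λ i → gs i a) ∷ʳ z)))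
  realizable-bounded {n} {f} IH gs rs = realizable-ext correct
    (realizable-∘ {λ p → fold (π₁ p) (λ z → φ ⟨ z , π₂ p ⟩)} {λ a → ⟨ gs (fromℕ n) a , a ⟩}
      (realizable-fold {φ} (IH hs hs-realizable))
      (realizable-⟨⟩ {gs (fromℕ n)} {id} (rs (fromℕ n)) realizable-id))
    where
    hs : Fin (suc n) → ℕ → ℕ
    hs = (λ j p → gs (inject₁ j) (π₂ p)) ▷ π₁
    hs-realizable : ∀ i → Realizable (hs i)
    hs-realizable = ▷-all Realizable {gs = λ j p → gs (inject₁ j) (π₂ p)} {b = π₁}
      (λ j → realizable-∘ {gs (inject₁ j)} {π₂} (rs (inject₁ j)) realizable-π₂) realizable-π₁
    hs-args : ∀ p → tabulate (λ i → hs i p) ≡ init (tabulate (λ i → gs i (π₂ p))) ∷ʳ π₁ p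
    hs-args p = trans (tabulate-▷ (λ j p → gs (inject₁ j) (π₂ p)) π₁ p)
      (cong (_∷ʳ π₁ p) (sym (init-tabulate (λ i → gs i (π₂ p)))))
    φ : ℕ → ℕ
    φ p = f (tabulate λ i → hs i p)
    φ-⟨⟩ : ∀ z a → φ ⟨ z , a ⟩ ≡ f (init (tabulate λ i → gs i a) ∷ʳ z)
    φ-⟨⟩ z a = cong f (trans (hs-args ⟨ z , a ⟩)
      (cong₂ (λ a z → init (tabulate λ i → gs i a) ∷ʳ z) (π₂-⟨⟩ z a) (π₁-⟨⟩ z a)))
    correct : ∀ a → fold (π₁ ⟨ gs (fromℕ n) a , a ⟩) (λ z → φ ⟨ z , π₂ ⟨ gs (fromℕ n) a , a ⟩ ⟩) ≡
                    fold (last (tabulate λ i → gs i a)) (λ z → f (init (tabulate λ i → gs i a) ∷ʳ z))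
    correct a rewrite π₁-⟨⟩ (gs (fromℕ n) a) a | π₂-⟨⟩ (gs (fromℕ n) a) a | last-tabulate (λ i → gs i a) =
      fold-cong (gs (fromℕ n) a) (λ {z} _ → φ-⟨⟩ z a)

-- Realizability of elementary functions and the basis theorem.

realizable-arguments : ∀ {f : Op (suc n)} → KalmárElementary n f →
  ∀ (gs : Fin (suc n) → ℕ → ℕ) → (∀ i → Realizable (gs i)) → Realizable (λ a → f (tabulate λ i → gs i a))
realizable-arguments (constant c) gs rs = realizable-const c
realizable-arguments (projection i) gs rs =
  realizable-ext (λ a → sym (lookup∘tabulate (λ i → gs i a) i)) (rs i)
realizable-arguments addition gs rs = realizable-ext
  (λ a → cong₂ _+_ (π₁-⟨⟩ (gs 0F a) (gs 1F a)) (π₂-⟨⟩ (gs 0F a) (gs 1F a)))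
  (realizable-∘ {λ p → π₁ p + π₂ p} {λ a → ⟨ gs 0F a , gs 1F a ⟩} realizable-+
    (realizable-⟨⟩ {gs 0F} {gs 1F} (rs 0F) (rs 1F)))
realizable-arguments monus gs rs = realizable-ext
  (λ a → cong₂ _∸_ (π₁-⟨⟩ (gs 0F a) (gs 1F a)) (π₂-⟨⟩ (gs 0F a) (gs 1F a)))
  (realizable-∘ {λ p → π₁ p ∸ π₂ p} {λ a → ⟨ gs 0F a , gs 1F a ⟩} realizable-∸
    (realizable-⟨⟩ {gs 0F} {gs 1F} (rs 0F) (rs 1F)))
-- The induction hypothesis for the outer function is used at a new family of arguments, so the
-- statement ranges over all realizable families.
realizable-arguments (substitution {g = g} kf kg) gs rs =
  realizable-arguments kf (λ i a → g i (tabulate λ j → gs j a)) (λ i → realizable-arguments (kg i) gs rs)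
realizable-arguments (summation {f = f} kf) = realizable-bounded {fold = ∑<}
  (λ n eq → cong sum (applyUpTo-cong-< n eq)) (generator (there (there (there (here refl))))) {f = f}
  (realizable-arguments kf)
realizable-arguments (multiplication {f = f} kf) = realizable-bounded {fold = ∏<}
  (λ n eq → cong product (applyUpTo-cong-< n eq)) (generator (there (there (there (there (here refl)))))) {f = f}
  (realizable-arguments kf)
realizable-arguments (ext f≗g kf) gs rs =
  realizable-ext (λ a → f≗g (tabulate λ i → gs i a)) (realizable-arguments kf gs rs)

-- On a singleton, `complete` and `sound` leave exactly one row in the result, and its second
-- component is still the 0 that `output` looks up.
run-singleton : ∀ {f} (P : Realizable f) x → output (run P (input x)) ≡ f x
run-singleton {f} P x = valueAt-unique
  (subst (_∈ run P (input x)) act-f (complete P (λ eq → contradiction (trans (sym (bit-2^ p)) eq) λ ())))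
  (λ t∈ _ → unique t∈)
  where
  p = ⟨ x , 0 ⟩
  act-f : act f p ≡ ⟨ f x , 0 ⟩
  act-f = cong₂ (λ a r → ⟨ f a , r ⟩) (π₁-⟨⟩ x 0) (π₂-⟨⟩ x 0)
  unique : ∀ {t} → t ∈ run P (input x) → t ≡ ⟨ f x , 0 ⟩
  unique t∈ with sound P t∈
  ... | s , s∈ , t≡ = trans t≡ (trans (cong (act f) (∈2^ s p s∈)) act-f)

elementary⇒closure : ∀ {f} → UnaryKalmárElementary f → SubstitutionClosure basis f
elementary⇒closure {f} kf = ext (run-singleton P)
  (composition (generator (there (here refl))) (composition (closed P) (generator (here refl))))
  where
  P : Realizable f
  -- With the identity as the only argument, the tabulated vector is `a ∷ []` and `head` computes,
  -- so the realized function is `f` itself.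
  P = realizable-arguments kf (const id) (const realizable-id)

theorem17 : Σ[ U ∈ List (ℕ → ℕ) ] IsSubstitutionBasis U UnaryKalmárElementary
theorem17 = basis , closure⇒elementary , elementary⇒closure
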